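{- Let $L$ be a regular pseudocomplemented de Morgan algebra with dual $pm$-space $P$. If there exist $x,y\in P$ with $\ell_\zeta(x,y)=n$ for some $1\le n<\omega$, then $L$ does not satisfy the identity $(x\wedge x^{\prime\ast})^{(n-1)(\prime\ast)}\approx(x\wedge x^{\prime\ast})^{n(\prime\ast)}$.
   Context: A $pm$-algebra is $(L;\wedge,\vee,{}^\ast,{}^\prime,0,1)$ with bounded distributive lattice reduct, pseudocomplement ${}^\ast$ and de Morgan involution ${}^\prime$; it is regular if any two congruences sharing a class are equal. Its dual $pm$-space $(P;\tau,\le,\zeta)$ is its Priestley space of prime ideals with the order-reversing involution $\zeta(I)=\{a:a'\notin I\}$. Notation: $x^{0(\prime\ast)}=x$, $x^{(k+1)(\prime\ast)}=((x^{k(\prime\ast)})')^\ast$. $\ell(x,y)$ is the distance between $x$ and $y$ in the comparability graph of $(P;\le)$ ($0$ if $x=y$, $\infty$ if not connected). The $\zeta$-distance is $\ell_\zeta(x,y)=\min\{\ell(x,y),\ell(x,\zeta(y))\}$. -}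

module Defs where

open import Algebra.Core using (Op₁; Op₂)
open import Algebra.Lattice.Bundles using (Lattice)
open import Algebra.Lattice.Structures using (IsDistributiveLattice)
open import Axiom.ExcludedMiddle using (ExcludedMiddle)
open import Data.Nat.Base using (ℕ; zero; suc; _≤_; z≤n; s≤s; _⊓_)
open import Data.Product.Base using (∃; _×_; _,_; proj₁; proj₂)
open import Data.Sum.Base using (_⊎_; inj₁; inj₂; [_,_]′)
open import Function.Bundles using (_⇔_)
open import Level using (_⊔_) renaming (suc to lsuc)
open import Relation.Binary.Bundles using (Poset)
open import Relation.Binary.Core using (Rel) renaming (_⇔_ to _⇔ᴿ_)
open import Relation.Binary.Structures using (IsEquivalence)
open import Relation.Nullary using (¬_; Dec; yes; no; contradiction)
open import Relation.Nullary.Construct.Add.Supremum using (_⁺; ⊤⁺; [_])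
open import Relation.Unary using (Pred; _∈_; _∉_; _⊆_; _≐_)

import Algebra.Definitions as AlgDefs
import Algebra.Lattice.Properties.Lattice as LatticeProperties
import Relation.Binary.Reasoning.Setoid as ≈-Reasoning

------------------------------------------------------------------------
-- Priestley duality needs classical logic and prime ideals obtained by
-- choice.  Choice enters as Zorn's lemma, to be assumed explicitly along
-- with excluded middle.  The empty chain is allowed, so the chain
-- condition makes P nonempty.

ZornsLemma : ∀ a ℓ₁ ℓ₂ r → Set (lsuc (a ⊔ ℓ₁ ⊔ ℓ₂ ⊔ r))
ZornsLemma a ℓ₁ ℓ₂ r = (P : Poset a ℓ₁ ℓ₂) → let open Poset P renaming (_≤_ to _≼_) in
  ((C : Pred Carrier r) →
    (∀ {x y} → x ∈ C → y ∈ C → x ≼ y ⊎ y ≼ x) →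
    ∃ λ u → ∀ {x} → x ∈ C → x ≼ u) →
  ∃ λ m → ∀ {x} → m ≼ x → x ≼ m

------------------------------------------------------------------------
-- Pseudocomplemented de Morgan algebras

record PMAlgebra c ℓ : Set (lsuc (c ⊔ ℓ)) where
  infix  9 _* _′
  infixl 8 _⟨′*⟩^_
  infixr 7 _∧_
  infixr 6 _∨_
  infix  4 _≈_ _≤ᴸ_
  field
    Carrier : Set c
    _≈_     : Rel Carrier ℓ
    _∧_     : Op₂ Carrier
    _∨_     : Op₂ Carrier
    _*      : Op₁ Carrier
    _′      : Op₁ Carrier
    𝟎       : Carrier
    𝟏       : Carrier

  _≤ᴸ_ : Rel Carrier ℓ
  x ≤ᴸ y = x ≈ x ∧ y

  open AlgDefs _≈_

  field
    isDistributiveLattice : IsDistributiveLattice _≈_ _∨_ _∧_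
    ∨-identity            : Identity 𝟎 _∨_
    ∧-identity            : Identity 𝟏 _∧_
    *-cong                : Congruent₁ _*
    *-pseudocomplement    : ∀ x y → (x ∧ y ≈ 𝟎) ⇔ (y ≤ᴸ x *)
    ′-cong                : Congruent₁ _′
    ′-involutive          : Involutive _′
    deMorgan-∧            : ∀ x y → (x ∧ y) ′ ≈ x ′ ∨ y ′
    deMorgan-∨            : ∀ x y → (x ∨ y) ′ ≈ x ′ ∧ y ′

  open IsDistributiveLattice isDistributiveLattice public

  -- x ⟨′*⟩^ k is x^{k(′*)}.
  _⟨′*⟩^_ : Carrier → ℕ → Carrier
  x ⟨′*⟩^ zero  = x
  x ⟨′*⟩^ suc k = (x ⟨′*⟩^ k) ′ *

module _ {c ℓ} (L : PMAlgebra c ℓ) where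
  open PMAlgebra L

  record IsCongruence {r} (θ : Rel Carrier r) : Set (c ⊔ ℓ ⊔ r) where
    field
      isEquivalenceᶜ : IsEquivalence θ
      ≈⇒θ            : ∀ {x y} → x ≈ y → θ x y
      ∧-compatible   : ∀ {x y u v} → θ x y → θ u v → θ (x ∧ u) (y ∧ v)
      ∨-compatible   : ∀ {x y u v} → θ x y → θ u v → θ (x ∨ u) (y ∨ v)
      *-compatible   : ∀ {x y} → θ x y → θ (x *) (y *)
      ′-compatible   : ∀ {x y} → θ x y → θ (x ′) (y ′)

  -- The class of a under θ is the predicate θ a.  Under excluded middle
  -- every relation is equivalent to one at level c ⊔ ℓ, so fixing this
  -- level loses no congruences; likewise for prime ideals below.
  Regular : Set (lsuc (c ⊔ ℓ))
  Regular = {θ φ : Rel Carrier (c ⊔ ℓ)} → IsCongruence θ → IsCongruence φ →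
            ∀ a b → θ a ≐ φ b → θ ⇔ᴿ φ

  ------------------------------------------------------------------------
  -- Prime ideals.  Equality in the dual space is ≐ of underlying sets.

  record PrimeIdeal : Set (lsuc (c ⊔ ℓ)) where
    field
      set      : Pred Carrier (c ⊔ ℓ)
      𝟎∈       : 𝟎 ∈ set
      down     : ∀ {x y} → x ≤ᴸ y → y ∈ set → x ∈ set
      ∨-closed : ∀ {x y} → x ∈ set → y ∈ set → x ∨ y ∈ set
      proper   : 𝟏 ∉ set
      prime    : ∀ {x y} → x ∧ y ∈ set → x ∈ set ⊎ y ∈ set

  open PrimeIdeal

  -- Adjacency in the comparability graph of (P; ≤), where ≤ is inclusion.
  Adjacent : Rel PrimeIdeal (c ⊔ ℓ)
  Adjacent I J = ¬ (set I ≐ set J) × (set I ⊆ set J ⊎ set J ⊆ set I)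

  data Walk : ℕ → Rel PrimeIdeal (lsuc (c ⊔ ℓ)) where
    stop : ∀ {I J} → set I ≐ set J → Walk zero I J
    step : ∀ {n I J K} → Adjacent I J → Walk n J K → Walk (suc n) I K

------------------------------------------------------------------------
-- Distances take values in ℕ ⁺ = ℕ ∪ {∞}, where ∞ is ⊤⁺.

_⊓⁺_ : Op₂ (ℕ ⁺)
⊤⁺    ⊓⁺ n     = n
[ m ] ⊓⁺ ⊤⁺    = [ m ]
[ m ] ⊓⁺ [ n ] = [ m ⊓ n ]

least : ∀ {p} {P : Pred ℕ p} → (∀ n → Dec (P n)) → ∀ n → P n →
        ∃ λ m → P m × (∀ k → P k → m ≤ k)
least P? zero    p = zero , p , λ _ _ → z≤n
least P? (suc n) p with P? zero
... | yes p₀ = zero , p₀ , λ _ _ → z≤n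
... | no ¬p₀ with least (λ k → P? (suc k)) n p
...   | m , pₘ , min = suc m , pₘ , λ where
          zero    p₀ → contradiction p₀ ¬p₀
          (suc k) pₖ → s≤s (min k pₖ)

-- Excluded middle is used to see that ζ I is prime, and to make the
-- distance a function.
module Dual (em : ∀ {a} → ExcludedMiddle a) {c ℓ} (L : PMAlgebra c ℓ) where
  open PMAlgebra L
  open PrimeIdeal

  private
    lattice : Lattice c ℓ
    lattice = record { isLattice = isLattice }

    open LatticeProperties lattice using (∧-idem)
    open ≈-Reasoning (Lattice.setoid lattice)

    ∈-resp : ∀ (I : PrimeIdeal L) {x y} → x ≈ y → x ∈ set I → y ∈ set I
    ∈-resp I {x} {y} x≈y = down I (trans (sym (∧-idem y)) (∧-cong refl (sym x≈y)))

    𝟎′≈𝟏 : 𝟎 ′ ≈ 𝟏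
    𝟎′≈𝟏 = begin
      𝟎 ′             ≈⟨ proj₂ ∧-identity (𝟎 ′) ⟨
      𝟎 ′ ∧ 𝟏         ≈⟨ ∧-cong refl (′-involutive 𝟏) ⟨
      𝟎 ′ ∧ 𝟏 ′ ′     ≈⟨ deMorgan-∨ 𝟎 (𝟏 ′) ⟨
      (𝟎 ∨ 𝟏 ′) ′     ≈⟨ ′-cong (proj₁ ∨-identity (𝟏 ′)) ⟩
      𝟏 ′ ′           ≈⟨ ′-involutive 𝟏 ⟩
      𝟏               ∎

    𝟎≈𝟏′ : 𝟎 ≈ 𝟏 ′
    𝟎≈𝟏′ = trans (sym (′-involutive 𝟎)) (′-cong 𝟎′≈𝟏)

    ′-antitone : ∀ {x y} → x ≤ᴸ y → y ′ ≤ᴸ x ′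
    ′-antitone {x} {y} x≤y = begin
      y ′                 ≈⟨ ∧-absorbs-∨ (y ′) (x ′) ⟨
      y ′ ∧ (y ′ ∨ x ′)   ≈⟨ ∧-cong refl (∨-comm (y ′) (x ′)) ⟩
      y ′ ∧ (x ′ ∨ y ′)   ≈⟨ ∧-cong refl (deMorgan-∧ x y) ⟨
      y ′ ∧ (x ∧ y) ′     ≈⟨ ∧-cong refl (′-cong x≤y) ⟨
      y ′ ∧ x ′           ∎

  ζ : PrimeIdeal L → PrimeIdeal L
  ζ I = record
    { set      = λ x → x ′ ∉ set I
    ; 𝟎∈       = λ 𝟎′∈I → proper I (∈-resp I 𝟎′≈𝟏 𝟎′∈I)
    ; down     = λ x≤y y′∉I x′∈I → y′∉I (down I (′-antitone x≤y) x′∈I)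
    ; ∨-closed = λ x′∉I y′∉I x∨y′∈I →
        [ x′∉I , y′∉I ]′ (prime I (∈-resp I (deMorgan-∨ _ _) x∨y′∈I))
    ; proper   = λ 𝟏′∉I → 𝟏′∉I (∈-resp I 𝟎≈𝟏′ (𝟎∈ I))
    ; prime    = ζ-prime
    }
    where
    ζ-prime : ∀ {x y} → (x ∧ y) ′ ∉ set I → x ′ ∉ set I ⊎ y ′ ∉ set I
    ζ-prime {x} {y} x∧y′∉I with em {P = x ′ ∈ set I} | em {P = y ′ ∈ set I}
    ... | no x′∉I  | _        = inj₁ x′∉I
    ... | yes _    | no y′∉I  = inj₂ y′∉I
    ... | yes x′∈I | yes y′∈I = contradiction
      (∈-resp I (sym (deMorgan-∧ x y)) (∨-closed I x′∈I y′∈I)) x∧y′∉I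

  dist : PrimeIdeal L → PrimeIdeal L → ℕ ⁺
  dist I J with em {P = ∃ λ n → Walk L n I J}
  ... | yes (n , walk) = [ proj₁ (least {P = λ k → Walk L k I J} (λ _ → em) n walk) ]
  ... | no  _          = ⊤⁺

  ζ-dist : PrimeIdeal L → PrimeIdeal L → ℕ ⁺
  ζ-dist I J = dist I J ⊓⁺ dist I (ζ J)

{-# OPTIONS --safe #-}
-- Regularity forces the congruence "x* ≈ y* and x′* ≈ y′*", whose class of 𝟏
-- is trivial, to be equality; hence x ∧ x′*′ ≤ y ∨ y*, and therefore no chain
-- of prime ideals has three members.
--
-- Write I ⟶ J for ζ I ⊆ J.  As every point of a path is minimal or maximal, a
-- path of length n between x and y becomes, up to ζ, a chain of n arrows from X
-- to Q, all of whose members are maximal.  Put I = ζ X and b = a ∧ a′*.  For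
-- a ∈ Q the chain gives b^{n(′*)} ∈ I, so the identity gives b^{(n-1)(′*)} ∈ I.
-- As this holds for all a ∈ Q, the prime ideal theorem yields a chain of at most
-- n arrows from I to some V ⊇ Q.  Any first arrow leads to X since X is maximal,
-- and V = Q since Q is maximal, so X and Q are joined by fewer than n arrows,
-- contradicting ℓ_ζ(x,y) = n.
module Submission where

open import Defs
open import Algebra.Lattice.Bundles using (Lattice)
open import Axiom.ExcludedMiddle using (ExcludedMiddle)
open import Data.Nat.Base using (ℕ; zero; suc; _≤_; _∸_; z≤n; s≤s)
open import Data.Nat.Properties using (⊓-sel; m⊓n≤m; m⊓n≤n; <⇒≱; m≤n⇒m≤1+n)
  renaming (≤-trans to ℕ-≤-trans)
open import Data.Product.Base using (∃; ∃₂; _×_; _,_; proj₁; proj₂)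
open import Data.Sum.Base using (_⊎_; inj₁; inj₂; [_,_]′; swap) renaming (map to ⊎-map)
open import Function.Base using (_∘_; id)
open import Function.Bundles using (module Equivalence)
open import Level using (Lift; lift; lower; _⊔_) renaming (suc to lsuc)
open import Relation.Binary.Bundles using (Poset)
open import Relation.Binary.Core using (Rel)
open import Relation.Binary.PropositionalEquality using (_≡_; subst) renaming (refl to ≡-refl; sym to ≡-sym)
open import Relation.Nullary using (¬_; yes; no; contradiction)
open import Relation.Nullary.Construct.Add.Supremum using (_⁺; ⊤⁺; [_])
open import Relation.Nullary.Decidable using (True; toWitness; fromWitness; decidable-stable)
open import Relation.Unary using (Pred; _∈_; _∉_; _⊆_; _≐_)

import Algebra.Lattice.Properties.Lattice as LatticeProperties
import Relation.Binary.Lattice as OrderTheoretic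
import Relation.Binary.Reasoning.Setoid as ≈-Reasoning

-- Order laws for the pseudocomplement and the involution.

module PMAlgebraProperties {c ℓ} (L : PMAlgebra c ℓ) where
  open PMAlgebra L

  lattice : Lattice c ℓ
  lattice = record { isLattice = isLattice }

  open OrderTheoretic.Lattice (LatticeProperties.∨-∧-orderTheoreticLattice lattice) public
    using (x≤x∨y; y≤x∨y; ∨-least; x∧y≤x; x∧y≤y; ∧-greatest; antisym)
    renaming (refl to ≤-refl; trans to ≤-trans; reflexive to ≤-reflexive)

  ∨-mono : ∀ {x y u v} → x ≤ᴸ y → u ≤ᴸ v → x ∨ u ≤ᴸ y ∨ v
  ∨-mono x≤y u≤v = ∨-least (≤-trans x≤y (x≤x∨y _ _)) (≤-trans u≤v (y≤x∨y _ _))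

  ∧-mono : ∀ {x y u v} → x ≤ᴸ y → u ≤ᴸ v → x ∧ u ≤ᴸ y ∧ v
  ∧-mono x≤y u≤v = ∧-greatest (≤-trans (x∧y≤x _ _) x≤y) (≤-trans (x∧y≤y _ _) u≤v)

  𝟎-least : ∀ x → 𝟎 ≤ᴸ x
  𝟎-least x = ≤-trans (x≤x∨y 𝟎 x) (≤-reflexive (proj₁ ∨-identity x))

  𝟏-greatest : ∀ x → x ≤ᴸ 𝟏
  𝟏-greatest x = sym (proj₂ ∧-identity x)

  ≤𝟎⇒≈𝟎 : ∀ {x} → x ≤ᴸ 𝟎 → x ≈ 𝟎
  ≤𝟎⇒≈𝟎 x≤𝟎 = antisym x≤𝟎 (𝟎-least _)

  disjoint⇒≤* : ∀ {x y} → x ∧ y ≈ 𝟎 → y ≤ᴸ x *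
  disjoint⇒≤* = Equivalence.to (*-pseudocomplement _ _)

  ≤*⇒disjoint : ∀ {x y} → y ≤ᴸ x * → x ∧ y ≈ 𝟎
  ≤*⇒disjoint = Equivalence.from (*-pseudocomplement _ _)

  x∧x*≈𝟎 : ∀ x → x ∧ x * ≈ 𝟎
  x∧x*≈𝟎 x = ≤*⇒disjoint ≤-refl

  *-antitone : ∀ {x y} → x ≤ᴸ y → y * ≤ᴸ x *
  *-antitone {x} {y} x≤y =
    disjoint⇒≤* (≤𝟎⇒≈𝟎 (≤-trans (∧-mono x≤y ≤-refl) (≤-reflexive (x∧x*≈𝟎 y))))

  𝟎*≈𝟏 : 𝟎 * ≈ 𝟏
  𝟎*≈𝟏 = antisym (𝟏-greatest _) (disjoint⇒≤* (proj₂ ∧-identity 𝟎))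

  𝟏*≈𝟎 : 𝟏 * ≈ 𝟎
  𝟏*≈𝟎 = trans (sym (proj₁ ∧-identity (𝟏 *))) (x∧x*≈𝟎 𝟏)

  ∨-* : ∀ x y → (x ∨ y) * ≈ x * ∧ y *
  ∨-* x y = antisym
    (∧-greatest (*-antitone (x≤x∨y x y)) (*-antitone (y≤x∨y x y)))
    (disjoint⇒≤* (≤𝟎⇒≈𝟎 (≤-trans
      (≤-reflexive (∧-distribʳ-∨ _ x y))
      (∨-least
        (≤-trans (∧-mono ≤-refl (x∧y≤x _ _)) (≤-reflexive (x∧x*≈𝟎 x)))
        (≤-trans (∧-mono ≤-refl (x∧y≤y _ _)) (≤-reflexive (x∧x*≈𝟎 y)))))))

  ′-antitone : ∀ {x y} → x ≤ᴸ y → y ′ ≤ᴸ x ′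
  ′-antitone {x} {y} x≤y =
    ≤-trans (y≤x∨y (x ′) (y ′)) (≤-reflexive (sym (trans (′-cong x≤y) (deMorgan-∧ x y))))

  𝟎′≈𝟏 : 𝟎 ′ ≈ 𝟏
  𝟎′≈𝟏 = antisym (𝟏-greatest _)
    (≤-trans (≤-reflexive (sym (′-involutive 𝟏))) (′-antitone (𝟎-least (𝟏 ′))))

  𝟏′≈𝟎 : 𝟏 ′ ≈ 𝟎
  𝟏′≈𝟎 = trans (′-cong (sym 𝟎′≈𝟏)) (′-involutive 𝟎)

  ′*-mono : ∀ {x y} → x ≤ᴸ y → x ′ * ≤ᴸ y ′ *
  ′*-mono = *-antitone ∘ ′-antitone

  ⟨′*⟩^-mono : ∀ n {x y} → x ≤ᴸ y → x ⟨′*⟩^ n ≤ᴸ y ⟨′*⟩^ n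
  ⟨′*⟩^-mono zero    x≤y = x≤y
  ⟨′*⟩^-mono (suc n) x≤y = ′*-mono (⟨′*⟩^-mono n x≤y)

  x∨x*-dense : ∀ x → (x ∨ x *) * ≈ 𝟎
  x∨x*-dense x = trans (∨-* x (x *)) (x∧x*≈𝟎 (x *))

  -- `x ′ * ′` is the dual pseudocomplement of `x`, so this is `x ′ ∧ x ′ * ≈ 𝟎` seen through the
  -- involution.
  x∨x′*′≈𝟏 : ∀ x → x ∨ x ′ * ′ ≈ 𝟏
  x∨x′*′≈𝟏 x = begin
    x ∨ x ′ * ′        ≈⟨ ∨-cong (′-involutive x) refl ⟨
    x ′ ′ ∨ x ′ * ′    ≈⟨ deMorgan-∧ (x ′) (x ′ *) ⟨
    (x ′ ∧ x ′ *) ′    ≈⟨ ′-cong (x∧x*≈𝟎 (x ′)) ⟩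
    𝟎 ′                ≈⟨ 𝟎′≈𝟏 ⟩
    𝟏                  ∎
    where open ≈-Reasoning (Lattice.setoid lattice)

  -- The Glivenko and determination congruences.

  Glivenko : Rel Carrier ℓ
  Glivenko x y = x * ≈ y *

  private
    -- `u ∧ w` is disjoint from `x`, hence below `x *`; as `x * ≈ y *`, it is disjoint from `y` too.
    ∧-*-≤ : ∀ {x y} u → Glivenko x y → (x ∧ u) * ≤ᴸ (y ∧ u) *
    ∧-*-≤ {x} {y} u x*≈y* = disjoint⇒≤* (trans (∧-assoc y u w)
      (≤*⇒disjoint (≤-trans
        (disjoint⇒≤* (trans (sym (∧-assoc x u w)) (x∧x*≈𝟎 (x ∧ u))))
        (≤-reflexive x*≈y*))))
      where w = (x ∧ u) *

    Glivenko-∧ˡ : ∀ {x y} u → Glivenko x y → Glivenko (x ∧ u) (y ∧ u)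
    Glivenko-∧ˡ u x*≈y* = antisym (∧-*-≤ u x*≈y*) (∧-*-≤ u (sym x*≈y*))

  Glivenko-∧ : ∀ {x y u v} → Glivenko x y → Glivenko u v → Glivenko (x ∧ u) (y ∧ v)
  Glivenko-∧ {x} {y} {u} {v} x*≈y* u*≈v* = begin
    (x ∧ u) *  ≈⟨ Glivenko-∧ˡ u x*≈y* ⟩
    (y ∧ u) *  ≈⟨ *-cong (∧-comm y u) ⟩
    (u ∧ y) *  ≈⟨ Glivenko-∧ˡ y u*≈v* ⟩
    (v ∧ y) *  ≈⟨ *-cong (∧-comm v y) ⟩
    (y ∧ v) *  ∎
    where open ≈-Reasoning (Lattice.setoid lattice)

  Glivenko-∨ : ∀ {x y u v} → Glivenko x y → Glivenko u v → Glivenko (x ∨ u) (y ∨ v)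
  Glivenko-∨ {x} {y} {u} {v} x*≈y* u*≈v* =
    trans (∨-* x u) (trans (∧-cong x*≈y* u*≈v*) (sym (∨-* y v)))

  -- Up to `′`, the second component compares dual pseudocomplements. `Lift` reaches the level fixed
  -- in `Regular`.
  Determination : Rel Carrier (c ⊔ ℓ)
  Determination x y = Lift c (Glivenko x y × Glivenko (x ′) (y ′))

  -- In the second component the de Morgan laws exchange meets and joins, and `′` swaps the two
  -- components.
  determination-isCongruence : IsCongruence L Determination
  determination-isCongruence = record
    { isEquivalenceᶜ = record
      { refl  = lift (refl , refl)
      ; sym   = λ (lift (p , q)) → lift (sym p , sym q)
      ; trans = λ (lift (p , q)) (lift (r , s)) → lift (trans p r , trans q s)
      }
    ; ≈⇒θ          = λ x≈y → lift (*-cong x≈y , *-cong (′-cong x≈y))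
    ; ∧-compatible = λ (lift (p , q)) (lift (r , s)) → lift
        ( Glivenko-∧ p r
        , trans (*-cong (deMorgan-∧ _ _)) (trans (Glivenko-∨ q s) (*-cong (sym (deMorgan-∧ _ _)))))
    ; ∨-compatible = λ (lift (p , q)) (lift (r , s)) → lift
        ( Glivenko-∨ p r
        , trans (*-cong (deMorgan-∨ _ _)) (trans (Glivenko-∧ q s) (*-cong (sym (deMorgan-∨ _ _)))))
    ; *-compatible = λ (lift (p , _)) → lift (*-cong p , *-cong (′-cong p))
    ; ′-compatible = λ (lift (p , q)) → lift
        (q , trans (*-cong (′-involutive _)) (trans p (*-cong (sym (′-involutive _)))))
    }

  ≈-isCongruence : IsCongruence L (λ x y → Lift c (x ≈ y))
  ≈-isCongruence = record
    { isEquivalenceᶜ = record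
      { refl  = lift refl
      ; sym   = λ (lift p) → lift (sym p)
      ; trans = λ (lift p) (lift q) → lift (trans p q)
      }
    ; ≈⇒θ          = lift
    ; ∧-compatible = λ (lift p) (lift q) → lift (∧-cong p q)
    ; ∨-compatible = λ (lift p) (lift q) → lift (∨-cong p q)
    ; *-compatible = λ (lift p) → lift (*-cong p)
    ; ′-compatible = λ (lift p) → lift (′-cong p)
    }

  -- The second component makes `x ′ *` the top, so `x ′`, being disjoint from it, is `𝟎`.
  determination-𝟏 : ∀ {x} → Determination 𝟏 x → 𝟏 ≈ x
  determination-𝟏 {x} (lift (_ , 𝟏′*≈x′*)) = begin
    𝟏      ≈⟨ 𝟎′≈𝟏 ⟨
    𝟎 ′    ≈⟨ ′-cong x′≈𝟎 ⟨
    x ′ ′  ≈⟨ ′-involutive x ⟩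
    x      ∎
    where
    open ≈-Reasoning (Lattice.setoid lattice)
    x′≈𝟎 : x ′ ≈ 𝟎
    x′≈𝟎 = begin
      x ′            ≈⟨ proj₂ ∧-identity (x ′) ⟨
      x ′ ∧ 𝟏        ≈⟨ ∧-cong refl (trans (*-cong 𝟏′≈𝟎) 𝟎*≈𝟏) ⟨
      x ′ ∧ 𝟏 ′ *    ≈⟨ ∧-cong refl 𝟏′*≈x′* ⟩
      x ′ ∧ x ′ *    ≈⟨ x∧x*≈𝟎 (x ′) ⟩
      𝟎              ∎

  -- Consequences of regularity in the algebra.

  module _ (regular : Regular L) where

    determination⇒≈ : ∀ {x y} → Determination x y → x ≈ y
    determination⇒≈ θxy = lower (proj₁
      (regular determination-isCongruence ≈-isCongruence 𝟏 𝟏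
        ((λ θ𝟏x → lift (determination-𝟏 θ𝟏x)) ,
         (λ (lift 𝟏≈x) → IsCongruence.≈⇒θ determination-isCongruence 𝟏≈x)))
      θxy)

    -- Both `f` and `e ′` are dense. Density of `f` gives `e ∨ f` and `f` the same pseudocomplement;
    -- density of `e ′` lets it be replaced by `𝟏` in `e ′ ∧ f ′`. So `e ∨ f` and `f` are congruent,
    -- hence equal.
    regular-≤ : ∀ x y → x ∧ x ′ * ′ ≤ᴸ y ∨ y *
    regular-≤ x y = ≤-trans (x≤x∨y e f) (≤-reflexive (determination⇒≈ (lift (e∨f∼f , e∨f′∼f′))))
      where
      open ≈-Reasoning (Lattice.setoid lattice)
      e = x ∧ x ′ * ′
      f = y ∨ y *

      e∨f∼f : Glivenko (e ∨ f) f
      e∨f∼f = trans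
        (≤𝟎⇒≈𝟎 (≤-trans (*-antitone (y≤x∨y e f)) (≤-reflexive (x∨x*-dense y))))
        (sym (x∨x*-dense y))

      e′∼𝟏 : Glivenko (e ′) 𝟏
      e′∼𝟏 = begin
        (x ∧ x ′ * ′) ′ *      ≈⟨ *-cong (deMorgan-∧ x (x ′ * ′)) ⟩
        (x ′ ∨ x ′ * ′ ′) *    ≈⟨ *-cong (∨-cong refl (′-involutive (x ′ *))) ⟩
        (x ′ ∨ x ′ *) *        ≈⟨ x∨x*-dense (x ′) ⟩
        𝟎                      ≈⟨ 𝟏*≈𝟎 ⟨
        𝟏 *                    ∎

      e∨f′∼f′ : Glivenko ((e ∨ f) ′) (f ′)
      e∨f′∼f′ = begin
        (e ∨ f) ′ *     ≈⟨ *-cong (deMorgan-∨ e f) ⟩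
        (e ′ ∧ f ′) *   ≈⟨ Glivenko-∧ e′∼𝟏 refl ⟩
        (𝟏 ∧ f ′) *     ≈⟨ *-cong (proj₁ ∧-identity (f ′)) ⟩
        f ′ *           ∎

-- The prime ideal theorem from Zorn's lemma.

module PrimeIdealTheorem
  (em : ∀ {a} → ExcludedMiddle a)
  (zorn : ∀ {a ℓ₁ ℓ₂ r} → ZornsLemma a ℓ₁ ℓ₂ r)
  {c ℓ} (L : PMAlgebra c ℓ) where

  open PMAlgebra L
  open PMAlgebraProperties L

  -- The level `r` is left free because the union of a chain of ideals lives one level higher.
  record IsIdeal {r} (S : Pred Carrier r) : Set (c ⊔ ℓ ⊔ r) where
    field
      𝟎∈       : 𝟎 ∈ S
      down     : ∀ {x y} → x ≤ᴸ y → y ∈ S → x ∈ S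
      ∨-closed : ∀ {x y} → x ∈ S → y ∈ S → x ∨ y ∈ S

  open IsIdeal

  _∨ᴵ_ : Pred Carrier (c ⊔ ℓ) → Pred Carrier (c ⊔ ℓ) → Pred Carrier (c ⊔ ℓ)
  (S ∨ᴵ T) z = ∃₂ λ u v → u ∈ S × v ∈ T × z ≤ᴸ u ∨ v

  module _ {S T : Pred Carrier (c ⊔ ℓ)} (S-ideal : IsIdeal S) (T-ideal : IsIdeal T) where

    ∨ᴵ-isIdeal : IsIdeal (S ∨ᴵ T)
    ∨ᴵ-isIdeal = record
      { 𝟎∈       = 𝟎 , 𝟎 , 𝟎∈ S-ideal , 𝟎∈ T-ideal , 𝟎-least _
      ; down     = λ x≤y (u , v , u∈S , v∈T , y≤u∨v) → u , v , u∈S , v∈T , ≤-trans x≤y y≤u∨v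
      ; ∨-closed = λ (u , v , u∈S , v∈T , x≤u∨v) (p , q , p∈S , q∈T , y≤p∨q) →
          u ∨ p , v ∨ q , ∨-closed S-ideal u∈S p∈S , ∨-closed T-ideal v∈T q∈T ,
          ∨-least (≤-trans x≤u∨v (∨-mono (x≤x∨y _ _) (x≤x∨y _ _)))
                  (≤-trans y≤p∨q (∨-mono (y≤x∨y _ _) (y≤x∨y _ _)))
      }

    ⊆∨ᴵˡ : S ⊆ S ∨ᴵ T
    ⊆∨ᴵˡ {x} x∈S = x , 𝟎 , x∈S , 𝟎∈ T-ideal , x≤x∨y _ _

    ⊆∨ᴵʳ : T ⊆ S ∨ᴵ T
    ⊆∨ᴵʳ {x} x∈T = 𝟎 , x , 𝟎∈ S-ideal , x∈T , y≤x∨y _ _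

  ↓_ : Carrier → Pred Carrier (c ⊔ ℓ)
  (↓ x) z = Lift c (z ≤ᴸ x)

  ↓-isIdeal : ∀ x → IsIdeal (↓ x)
  ↓-isIdeal x = record
    { 𝟎∈       = lift (𝟎-least x)
    ; down     = λ x≤y (lift y≤z) → lift (≤-trans x≤y y≤z)
    ; ∨-closed = λ (lift p) (lift q) → lift (∨-least p q)
    }

  module _ {G : Pred Carrier (c ⊔ ℓ)} (G-ideal : IsIdeal G) (𝟏∉G : 𝟏 ∉ G) where

    private
      record Extension : Set (lsuc (c ⊔ ℓ)) where
        constructor extension
        field
          mem     : Pred Carrier (c ⊔ ℓ)
          isIdeal : IsIdeal mem
          proper  : 𝟏 ∉ mem
          extends : G ⊆ mem
      open Extension

      extensions : Poset (lsuc (c ⊔ ℓ)) (c ⊔ ℓ) (c ⊔ ℓ)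
      extensions = record
        { Carrier        = Extension
        ; _≈_            = λ A B → mem A ≐ mem B
        ; _≤_            = λ A B → mem A ⊆ mem B
        ; isPartialOrder = record
          { isPreorder = record
            { isEquivalence = record
              { refl  = id , id
              ; sym   = λ (p , q) → q , p
              ; trans = λ (p , q) (r , s) → (λ z → r (p z)) , (λ z → q (s z))
              }
            ; reflexive = proj₁
            ; trans     = λ p q z → q (p z)
            }
          ; antisym = _,_
          }
        }

      module _ (C : Pred Extension (c ⊔ ℓ))
               (chain : ∀ {A B} → A ∈ C → B ∈ C → mem A ⊆ mem B ⊎ mem B ⊆ mem A) where

        -- Adjoining `G` makes this an extension of `G` even when the chain is empty.
        Union : Pred Carrier (lsuc (c ⊔ ℓ))
        Union z = z ∈ G ⊎ ∃ λ A → A ∈ C × z ∈ mem A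

        -- The union quantifies over Extension and is one level too high;
        -- excluded middle brings it back down.
        Union↓ : Pred Carrier (c ⊔ ℓ)
        Union↓ z = Lift (c ⊔ ℓ) (True (em {P = z ∈ Union}))

        Union-isIdeal : IsIdeal Union
        Union-isIdeal = record
          { 𝟎∈       = inj₁ (𝟎∈ G-ideal)
          ; down     = λ x≤y → ⊎-map (down G-ideal x≤y)
              (λ (A , A∈C , y∈A) → A , A∈C , down (isIdeal A) x≤y y∈A)
          ; ∨-closed = closed
          }
          where
          closed : ∀ {x y} → x ∈ Union → y ∈ Union → x ∨ y ∈ Union
          closed (inj₁ x∈G) (inj₁ y∈G) = inj₁ (∨-closed G-ideal x∈G y∈G)
          closed (inj₁ x∈G) (inj₂ (B , B∈C , y∈B)) =
            inj₂ (B , B∈C , ∨-closed (isIdeal B) (extends B x∈G) y∈B)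
          closed (inj₂ (A , A∈C , x∈A)) (inj₁ y∈G) =
            inj₂ (A , A∈C , ∨-closed (isIdeal A) x∈A (extends A y∈G))
          closed (inj₂ (A , A∈C , x∈A)) (inj₂ (B , B∈C , y∈B)) with chain A∈C B∈C
          ... | inj₁ A⊆B = inj₂ (B , B∈C , ∨-closed (isIdeal B) (A⊆B x∈A) y∈B)
          ... | inj₂ B⊆A = inj₂ (A , A∈C , ∨-closed (isIdeal A) x∈A (B⊆A y∈B))

        resize : Union ⊆ Union↓
        resize z∈U = lift (fromWitness z∈U)

        unresize : Union↓ ⊆ Union
        unresize (lift t) = toWitness t

        upperBound : ∃ λ U → ∀ {A} → A ∈ C → mem A ⊆ mem U
        upperBound = extension Union↓
            record
              { 𝟎∈       = resize (𝟎∈ Union-isIdeal)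
              ; down     = λ x≤y y∈U → resize (down Union-isIdeal x≤y (unresize y∈U))
              ; ∨-closed = λ x∈U y∈U → resize (∨-closed Union-isIdeal (unresize x∈U) (unresize y∈U))
              }
            ([ 𝟏∉G , (λ (A , _ , 𝟏∈A) → proper A 𝟏∈A) ]′ ∘ unresize)
            (λ z∈G → resize (inj₁ z∈G))
          , λ A∈C z∈A → resize (inj₂ (_ , A∈C , z∈A))

      maximal : ∃ λ M → ∀ {A} → mem M ⊆ mem A → mem A ⊆ mem M
      maximal = zorn {r = c ⊔ ℓ} extensions upperBound

      M : Extension
      M = proj₁ maximal

      -- Otherwise this join would be a proper extension of `M`, and maximality would put `x` in
      -- `M`.
      𝟏∈M∨↓ : ∀ {x} → x ∉ mem M → 𝟏 ∈ mem M ∨ᴵ (↓ x)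
      𝟏∈M∨↓ {x} x∉M = decidable-stable em λ 𝟏∉ → x∉M
        (proj₂ maximal
          {extension _ (∨ᴵ-isIdeal (isIdeal M) (↓-isIdeal x)) 𝟏∉
            (λ z∈G → ⊆∨ᴵˡ (isIdeal M) (↓-isIdeal x) (extends M z∈G))}
          (⊆∨ᴵˡ (isIdeal M) (↓-isIdeal x))
          (⊆∨ᴵʳ (isIdeal M) (↓-isIdeal x) (lift ≤-refl)))

      -- If neither were in `M`, then `𝟏 ≤ (u ∨ v) ∨ x` and `𝟏 ≤ (u ∨ v) ∨ y` with `u` and `v` in
      -- `M`; by distributivity `𝟏 ≤ (u ∨ v) ∨ (x ∧ y)`, which lies in `M`.
      M-prime : ∀ {x y} → x ∧ y ∈ mem M → x ∈ mem M ⊎ y ∈ mem M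
      M-prime {x} {y} x∧y∈M with em {P = x ∈ mem M} | em {P = y ∈ mem M}
      ... | yes x∈M | _       = inj₁ x∈M
      ... | no  _   | yes y∈M = inj₂ y∈M
      ... | no  x∉M | no  y∉M with 𝟏∈M∨↓ x∉M | 𝟏∈M∨↓ y∉M
      ...   | u , p , u∈M , lift p≤x , 𝟏≤u∨p | v , q , v∈M , lift q≤y , 𝟏≤v∨q =
        contradiction
          (down (isIdeal M)
            (≤-trans
              (∧-greatest (≤-trans 𝟏≤u∨p (∨-mono (x≤x∨y u v) p≤x))
                          (≤-trans 𝟏≤v∨q (∨-mono (y≤x∨y u v) q≤y)))
              (≤-reflexive (sym (∨-distribˡ-∧ (u ∨ v) x y))))
            (∨-closed (isIdeal M) (∨-closed (isIdeal M) u∈M v∈M) x∧y∈M))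
          (proper M)

    primeIdealTheorem : ∃ λ (K : PrimeIdeal L) → G ⊆ PrimeIdeal.set K
    primeIdealTheorem = record
        { set      = mem M
        ; 𝟎∈       = 𝟎∈ (isIdeal M)
        ; down     = down (isIdeal M)
        ; ∨-closed = ∨-closed (isIdeal M)
        ; proper   = proper M
        ; prime    = M-prime
        }
      , extends M

-- Points of the dual space, up to equality and up to `ζ`.

module DualProperties (em : ∀ {a} → ExcludedMiddle a) {c ℓ} (L : PMAlgebra c ℓ) where
  open PMAlgebra L
  open PMAlgebraProperties L
  open Dual em L
  open PrimeIdeal

  private
    P : Set (lsuc (c ⊔ ℓ))
    P = PrimeIdeal L

    variable
      I J K Q : P
      k n : ℕ

  -- A record, so that I and J can be inferred from a proof of I ≋ J.
  record _≋_ (I J : P) : Set (c ⊔ ℓ) where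
    constructor ⟪_⟫
    field
      sets-≐ : set I ≐ set J

  open _≋_

  ≋-refl : I ≋ I
  ≋-refl = ⟪ id , id ⟫

  ≋-sym : I ≋ J → J ≋ I
  ≋-sym ⟪ p , q ⟫ = ⟪ q , p ⟫

  ≋-trans : I ≋ J → J ≋ K → I ≋ K
  ≋-trans ⟪ p , q ⟫ ⟪ r , s ⟫ = ⟪ (λ z → r (p z)) , (λ z → q (s z)) ⟫

  ∈-resp : ∀ (I : P) {x y} → x ≈ y → x ∈ set I → y ∈ set I
  ∈-resp I x≈y = down I (≤-reflexive (sym x≈y))

  ζ-antitone : set I ⊆ set J → set (ζ J) ⊆ set (ζ I)
  ζ-antitone I⊆J x′∉J x′∈I = x′∉J (I⊆J x′∈I)

  ζ-cong : I ≋ J → ζ I ≋ ζ J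
  ζ-cong {I} {J} ⟪ p , q ⟫ = ⟪ ζ-antitone {J} {I} q , ζ-antitone {I} {J} p ⟫

  ζζ⊆ : set (ζ (ζ I)) ⊆ set I
  ζζ⊆ {I} x∈ζζI = ∈-resp I (′-involutive _) (decidable-stable em x∈ζζI)

  ⊆ζζ : set I ⊆ set (ζ (ζ I))
  ⊆ζζ {I} x∈I x″∉I = x″∉I (∈-resp I (sym (′-involutive _)) x∈I)

  ζζ≋ : ζ (ζ I) ≋ I
  ζζ≋ {I} = ⟪ ζζ⊆ {I} , ⊆ζζ {I} ⟫

  ζ-reflects : ζ I ≋ ζ J → I ≋ J
  ζ-reflects ζI≋ζJ = ≋-trans (≋-sym ζζ≋) (≋-trans (ζ-cong ζI≋ζJ) ζζ≋)

  _∼_ : Rel P (c ⊔ ℓ)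
  I ∼ J = I ≋ J ⊎ I ≋ ζ J

  ∼-ζ : ζ I ∼ I
  ∼-ζ = inj₂ ≋-refl

  ∼-trans : I ∼ J → J ∼ K → I ∼ K
  ∼-trans (inj₁ I≋J)  (inj₁ J≋K)  = inj₁ (≋-trans I≋J J≋K)
  ∼-trans (inj₁ I≋J)  (inj₂ J≋ζK) = inj₂ (≋-trans I≋J J≋ζK)
  ∼-trans (inj₂ I≋ζJ) (inj₁ J≋K)  = inj₂ (≋-trans I≋ζJ (ζ-cong J≋K))
  ∼-trans (inj₂ I≋ζJ) (inj₂ J≋ζK) = inj₁ (≋-trans I≋ζJ (≋-trans (ζ-cong J≋ζK) ζζ≋))

  -- Walks in the comparability graph.

  stop-≋ : I ≋ J → Walk L zero I J
  stop-≋ ⟪ I≐J ⟫ = stop I≐J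

  step-≋ : ¬ (I ≋ J) → set I ⊆ set J ⊎ set J ⊆ set I → Walk L n J K → Walk L (suc n) I K
  step-≋ I≇J cmp = step ((λ I≐J → I≇J ⟪ I≐J ⟫) , cmp)

  Walk-respˡ : I ≋ J → Walk L n I K → Walk L n J K
  Walk-respˡ I≋J (stop I≐K) = stop-≋ (≋-trans (≋-sym I≋J) ⟪ I≐K ⟫)
  Walk-respˡ I≋J@(⟪ I⊆J , J⊆I ⟫) (step (I≢K , cmp) w) =
    step-≋ (λ J≋K → I≢K (sets-≐ (≋-trans I≋J J≋K)))
      (⊎-map (λ I⊆K z → I⊆K (J⊆I z)) (λ K⊆I z → I⊆J (K⊆I z)) cmp) w

  Walk-respʳ : J ≋ K → Walk L n I J → Walk L n I K
  Walk-respʳ J≋K (stop I≐J)   = stop-≋ (≋-trans ⟪ I≐J ⟫ J≋K)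
  Walk-respʳ J≋K (step adj w) = step adj (Walk-respʳ J≋K w)

  Walk-ζ : Walk L n I J → Walk L n (ζ I) (ζ J)
  Walk-ζ (stop I≐J) = stop-≋ (ζ-cong ⟪ I≐J ⟫)
  Walk-ζ (step {I = I} {J = J} (I≢J , cmp) w) =
    step-≋ (λ ζI≋ζJ → I≢J (sets-≐ (ζ-reflects ζI≋ζJ)))
      (swap (⊎-map (ζ-antitone {I} {J}) (ζ-antitone {J} {I}) cmp))
      (Walk-ζ w)

  ζ-Walk : ℕ → Rel P (lsuc (c ⊔ ℓ))
  ζ-Walk n I J = Walk L n I J ⊎ Walk L n I (ζ J)

  -- Passing to `ζ` at the far end swaps the two alternatives. At the near end the whole walk is
  -- reflected by `ζ`, which swaps them as well.
  ζ-Walk-resp : ∀ {I I′ J J′} → I ∼ I′ → J ∼ J′ → ζ-Walk n I J → ζ-Walk n I′ J′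
  ζ-Walk-resp {n} I∼I′ J∼J′ w = moveˡ I∼I′ (moveʳ J∼J′ w)
    where
    moveʳ : ∀ {I J J′} → J ∼ J′ → ζ-Walk n I J → ζ-Walk n I J′
    moveʳ (inj₁ J≋J′)  (inj₁ w) = inj₁ (Walk-respʳ J≋J′ w)
    moveʳ (inj₁ J≋J′)  (inj₂ w) = inj₂ (Walk-respʳ (ζ-cong J≋J′) w)
    moveʳ (inj₂ J≋ζJ′) (inj₁ w) = inj₂ (Walk-respʳ J≋ζJ′ w)
    moveʳ (inj₂ J≋ζJ′) (inj₂ w) = inj₁ (Walk-respʳ (≋-trans (ζ-cong J≋ζJ′) ζζ≋) w)

    moveˡ : ∀ {I I′ J} → I ∼ I′ → ζ-Walk n I J → ζ-Walk n I′ J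
    moveˡ (inj₁ I≋I′)  w        = ⊎-map (Walk-respˡ I≋I′) (Walk-respˡ I≋I′) w
    moveˡ (inj₂ I≋ζI′) (inj₁ w) = inj₂ (Walk-respˡ (≋-trans (ζ-cong I≋ζI′) ζζ≋) (Walk-ζ w))
    moveˡ (inj₂ I≋ζI′) (inj₂ w) =
      inj₁ (Walk-respˡ (≋-trans (ζ-cong I≋ζI′) ζζ≋) (Walk-respʳ ζζ≋ (Walk-ζ w)))

  -- Distances as least walk lengths.

  private
    DistSpec : P → P → ℕ ⁺ → Set (lsuc (c ⊔ ℓ))
    DistSpec I J ⊤⁺    = ∀ k → ¬ Walk L k I J
    DistSpec I J [ n ] = Walk L n I J × (∀ k → Walk L k I J → n ≤ k)

    dist-spec : ∀ I J → DistSpec I J (dist I J)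
    dist-spec I J with em {P = ∃ λ n → Walk L n I J}
    ... | yes (n , walk) = proj₂ (least {P = λ k → Walk L k I J} (λ _ → em) n walk)
    ... | no  ¬walk      = λ k walk → ¬walk (k , walk)

  ζ-dist-spec : ζ-dist I J ≡ [ n ] → ζ-Walk n I J × (∀ k → ζ-Walk k I J → n ≤ k)
  ζ-dist-spec {I} {J} eq
    with dist I J | dist I (ζ J) | dist-spec I J | dist-spec I (ζ J)
  ζ-dist-spec ≡-refl | ⊤⁺ | [ n ] | none | walk , min =
    inj₂ walk , λ k → [ (λ w → contradiction w (none k)) , min k ]′
  ζ-dist-spec ≡-refl | [ n ] | ⊤⁺ | walk , min | none =
    inj₁ walk , λ k → [ min k , (λ w → contradiction w (none k)) ]′
  ζ-dist-spec {I} {J} ≡-refl | [ m ] | [ n ] | walk₁ , min₁ | walk₂ , min₂ =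
      ⊎-map (λ e → subst (λ k → Walk L k I J) (≡-sym e) walk₁)
            (λ e → subst (λ k → Walk L k I (ζ J)) (≡-sym e) walk₂)
            (⊓-sel m n)
    , λ k → [ (λ w → ℕ-≤-trans (m⊓n≤m m n) (min₁ k w))
            , (λ w → ℕ-≤-trans (m⊓n≤n m n) (min₂ k w)) ]′

  -- Arrows and chains of prime ideals.

  _⟶_ : Rel P (c ⊔ ℓ)
  I ⟶ J = set (ζ I) ⊆ set J

  data Chain : ℕ → Rel P (lsuc (c ⊔ ℓ)) where
    []  : Chain zero I I
    _∷_ : I ⟶ J → Chain n J K → Chain (suc n) I K

  -- An arrow from `I` is an inclusion starting at `ζ I`, and `I` may be traded for `ζ I`. Arrows
  -- whose inclusion is an equality contribute no step, so the length may drop.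
  chain⇒walk : Chain n I J → ∃ λ k → k ≤ n × ζ-Walk k I J
  chain⇒walk [] = zero , z≤n , inj₁ (stop-≋ ≋-refl)
  chain⇒walk {I = I} (_∷_ {J = K} I⟶K chain) with chain⇒walk chain | em {P = ζ I ≋ K}
  ... | k , k≤n , w | yes ζI≋K =
    k , m≤n⇒m≤1+n k≤n , ζ-Walk-resp (∼-trans (inj₁ (≋-sym ζI≋K)) ∼-ζ) (inj₁ ≋-refl) w
  ... | k , k≤n , w | no ζI≇K =
    suc k , s≤s k≤n , ζ-Walk-resp ∼-ζ (inj₁ ≋-refl)
      (⊎-map (step-≋ ζI≇K (inj₁ I⟶K)) (step-≋ ζI≇K (inj₁ I⟶K)) w)

  -- If `x ′ *` were outside `I`, then `x ′ * ′` would lie in `ζ I`, hence in `J`, and its join with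
  -- `x` is `𝟏`. Reading `x ∉ I` as truth at `I`, the operator `′*` is a box for the relation `⟶`.
  ⟶-′* : I ⟶ J → ∀ {x} → x ∈ set J → x ′ * ∈ set I
  ⟶-′* {I} {J} I⟶J {x} x∈J = decidable-stable em λ x′*∉I →
    proper J (∈-resp J (x∨x′*′≈𝟏 x)
      (∨-closed J x∈J (I⟶J λ x′*″∈I → x′*∉I (∈-resp I (′-involutive _) x′*″∈I))))

  -- The last arrow yields `a ′ *`, and so the meet with `a`, at exponent zero; every earlier arrow
  -- adds one `′*`. Hence the exponent is one less than the number of arrows.
  chain⇒∈ : Chain (suc n) I Q → ∀ {a} → a ∈ set Q → (a ∧ a ′ *) ⟨′*⟩^ n ∈ set I
  chain⇒∈ {I = I} {Q} (I⟶Q ∷ []) a∈Q = down I (x∧y≤y _ _) (⟶-′* {I} {Q} I⟶Q a∈Q)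
  chain⇒∈ {I = I} (_∷_ {J = J} I⟶J chain@(_ ∷ _)) a∈Q = ⟶-′* {I} {J} I⟶J (chain⇒∈ chain a∈Q)

  -- Maximal prime ideals of a regular algebra.

  Maximal : Pred P (lsuc (c ⊔ ℓ))
  Maximal I = ∀ J → set I ⊆ set J → I ≋ J

  module _ (regular : Regular L) where

    -- Given `b` in `J` outside `I` and `a` in `K` outside `J`, primality of `I` puts `b *` in `I`,
    -- so `b ∨ b *` is in `J` and `regular-≤` puts `a ∧ a ′ * ′` there. As `a` is not in `J`,
    -- `a ′ * ′` is, and then `K` contains `a ∨ a ′ * ′ ≈ 𝟏`.
    ⊊⇒maximal : set I ⊆ set J → ¬ (I ≋ J) → Maximal J
    ⊊⇒maximal {I} {J} I⊆J I≇J K J⊆K = ⟪_⟫ (J⊆K , λ {a} a∈K → decidable-stable em λ a∉J →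
      I≇J ⟪ I⊆J , (λ {b} b∈J → decidable-stable em λ b∉I → absurd a∈K a∉J b∈J b∉I) ⟫)
      where
      absurd : ∀ {a b} → a ∈ set K → a ∉ set J → b ∈ set J → ¬ (b ∉ set I)
      absurd {a} {b} a∈K a∉J b∈J b∉I with prime I (∈-resp I (sym (x∧x*≈𝟎 b)) (𝟎∈ I))
      ... | inj₁ b∈I  = b∉I b∈I
      ... | inj₂ b*∈I with prime J (down J (regular-≤ regular a b) (∨-closed J b∈J (I⊆J b*∈I)))
      ...   | inj₁ a∈J    = a∉J a∈J
      ...   | inj₂ a′*′∈J = proper K (∈-resp K (x∨x′*′≈𝟏 a) (∨-closed K a∈K (J⊆K a′*′∈J)))

    ⊊⇒ζ-maximal : set I ⊆ set J → ¬ (I ≋ J) → Maximal (ζ I)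
    ⊊⇒ζ-maximal {I} {J} I⊆J I≇J = ⊊⇒maximal {ζ J} {ζ I} (ζ-antitone {I} {J} I⊆J) λ ζJ≋ζI →
      I≇J (ζ-reflects (≋-sym ζJ≋ζI))

    maximal-rep : Adjacent L I J → ∃ λ X → X ∼ I × Maximal X
    maximal-rep {I} {J} (I≢J , inj₁ I⊆J) =
      ζ I , ∼-ζ , ⊊⇒ζ-maximal {I} {J} I⊆J (I≢J ∘ sets-≐)
    maximal-rep {I} {J} (I≢J , inj₂ J⊆I) =
      I , inj₁ ≋-refl , ⊊⇒maximal {J} {I} J⊆I (I≢J ∘ sets-≐ ∘ ≋-sym)

    -- Maximality of `X` excludes the two cases where the inclusion would enlarge `X`. In the others
    -- `X` is `ζ I` below `J`, with `Y` equal to `J`, or `X` is `I` above `J`, with `Y` equal to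
    -- `ζ J`.
    adjacent⇒⟶ : ∀ {X} → X ∼ I → Maximal X → Adjacent L I J →
                 ∃ λ Y → Y ∼ J × Maximal Y × X ⟶ Y
    adjacent⇒⟶ {I} {J} (inj₁ X≋I@(⟪ X⊆I , _ ⟫)) X-max (I≢J , inj₁ I⊆J) =
      contradiction (sets-≐ (≋-trans (≋-sym X≋I) (X-max J (λ z → I⊆J (X⊆I z))))) I≢J
    adjacent⇒⟶ {I} {J} {X} (inj₂ ⟪ _ , ζI⊆X ⟫) X-max (I≢J , inj₁ I⊆J) =
      J , inj₁ ≋-refl , ⊊⇒maximal {I} {J} I⊆J (I≢J ∘ sets-≐) ,
      λ z → I⊆J (ζζ⊆ {I} (ζ-antitone {ζ I} {X} ζI⊆X z))
    adjacent⇒⟶ {I} {J} {X} (inj₁ ⟪ _ , I⊆X ⟫) X-max (I≢J , inj₂ J⊆I) =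
      ζ J , ∼-ζ , ⊊⇒ζ-maximal {J} {I} J⊆I (I≢J ∘ sets-≐ ∘ ≋-sym) ,
      λ z → ζ-antitone {J} {X} (λ j → I⊆X (J⊆I j)) z
    adjacent⇒⟶ {I} {J} (inj₂ X≋ζI@(⟪ X⊆ζI , _ ⟫)) X-max (I≢J , inj₂ J⊆I) =
      contradiction
        (sets-≐ (ζ-reflects (≋-trans (≋-sym X≋ζI)
          (X-max (ζ J) (λ z → ζ-antitone {J} {I} J⊆I (X⊆ζI z)))))) I≢J

    walk⇒chain : ∀ {X} → X ∼ I → Maximal X → Walk L n I J →
                 ∃ λ Q → Q ∼ J × Maximal Q × Chain n X Q
    walk⇒chain {X = X} X∼I X-max (stop I≐J) = X , ∼-trans X∼I (inj₁ ⟪ I≐J ⟫) , X-max , []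
    walk⇒chain X∼I X-max (step adj w) with adjacent⇒⟶ X∼I X-max adj
    ... | Y , Y∼Z , Y-max , X⟶Y with walk⇒chain Y∼Z Y-max w
    ...   | Q , Q∼J , Q-max , chain = Q , Q∼J , Q-max , X⟶Y ∷ chain

  -- Chains recovered from membership conditions.

  module _ (zorn : ∀ {a ℓ₁ ℓ₂ r} → ZornsLemma a ℓ₁ ℓ₂ r) where
    open PrimeIdealTheorem em zorn L

    -- ζ I and g[Q] generate a proper ideal: were 𝟏 ≤ u ∨ g a with u ∈ ζ I and
    -- a ∈ Q, then u ′ ≤ (g a) ′ * ∈ I.
    ⟶-exists : ∀ (I Q : P) (g : Carrier → Carrier) → (∀ {x y} → x ≤ᴸ y → g x ≤ᴸ g y) →
      (∀ {a} → a ∈ set Q → g a ′ * ∈ set I) →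
      ∃ λ K → I ⟶ K × (∀ {a} → a ∈ set Q → g a ∈ set K)
    ⟶-exists I Q g g-mono g′*∈I =
        proj₁ extended
      , (λ z → proj₂ extended (⊆∨ᴵˡ ζI-ideal gQ-ideal z))
      , (λ {a} a∈Q → proj₂ extended (⊆∨ᴵʳ ζI-ideal gQ-ideal (a , a∈Q , ≤-refl)))
      where
      gQ : Pred Carrier (c ⊔ ℓ)
      gQ z = ∃ λ a → a ∈ set Q × z ≤ᴸ g a

      gQ-ideal : IsIdeal gQ
      gQ-ideal = record
        { 𝟎∈       = 𝟎 , 𝟎∈ Q , 𝟎-least _
        ; down     = λ x≤y (a , a∈Q , y≤ga) → a , a∈Q , ≤-trans x≤y y≤ga
        -- Monotonicity suffices here: `g (a ∨ b)` bounds both `g a` and `g b`.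
        ; ∨-closed = λ (a , a∈Q , x≤ga) (b , b∈Q , y≤gb) →
            a ∨ b , ∨-closed Q a∈Q b∈Q ,
            ∨-least (≤-trans x≤ga (g-mono (x≤x∨y a b))) (≤-trans y≤gb (g-mono (y≤x∨y a b)))
        }

      ζI-ideal : IsIdeal (set (ζ I))
      ζI-ideal = record { 𝟎∈ = 𝟎∈ (ζ I) ; down = down (ζ I) ; ∨-closed = ∨-closed (ζ I) }

      𝟏∉ : 𝟏 ∉ set (ζ I) ∨ᴵ gQ
      𝟏∉ (u , v , u′∉I , (a , a∈Q , v≤ga) , 𝟏≤u∨v) = u′∉I (down I
        (disjoint⇒≤* (trans (sym (deMorgan-∨ (g a) u)) (≤𝟎⇒≈𝟎 (≤-trans
          (′-antitone (≤-trans 𝟏≤u∨v (∨-least (y≤x∨y _ _) (≤-trans v≤ga (x≤x∨y _ _)))))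
          (≤-reflexive 𝟏′≈𝟎)))))
        (g′*∈I a∈Q))

      extended = primeIdealTheorem (∨ᴵ-isIdeal ζI-ideal gQ-ideal) 𝟏∉

    -- A converse to `chain⇒∈`, uniform in `a`: each outer `′*` is peeled off by one arrow from
    -- `⟶-exists`. At exponent zero either `Q` is already inside `I` or one further arrow reaches a
    -- point above `Q`, whence the bound `suc n`.
    ∈⇒chain : ∀ n (I Q : P) → (∀ {a} → a ∈ set Q → (a ∧ a ′ *) ⟨′*⟩^ n ∈ set I) →
      ∃₂ λ k V → k ≤ suc n × Chain k I V × set Q ⊆ set V
    ∈⇒chain zero I Q b∈I with em {P = ∃ λ a → a ∈ set Q × a ∉ set I}
    ... | no none = zero , I , z≤n , [] ,
      λ {a} a∈Q → decidable-stable em λ a∉I → none (a , a∈Q , a∉I)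
    ... | yes (a , a∈Q , a∉I) with ⟶-exists I Q id id a′*∈I
      where
      -- Joining with the fixed `a` outside `I` forces the same alternative of primality for every
      -- `d`.
      a′*∈I : ∀ {d} → d ∈ set Q → d ′ * ∈ set I
      a′*∈I {d} d∈Q with prime I (b∈I (∨-closed Q a∈Q d∈Q))
      ... | inj₁ a∨d∈I    = contradiction (down I (x≤x∨y a d) a∨d∈I) a∉I
      ... | inj₂ a∨d′*∈I  = down I (′*-mono (y≤x∨y a d)) a∨d′*∈I
    ...   | K , I⟶K , Q⊆K = 1 , K , s≤s z≤n , I⟶K ∷ [] , Q⊆K
    ∈⇒chain (suc n) I Q b∈I
      with ⟶-exists I Q (λ a → (a ∧ a ′ *) ⟨′*⟩^ n)
             (λ x≤y → ⟨′*⟩^-mono n (∧-mono x≤y (′*-mono x≤y))) b∈I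
    ... | K , I⟶K , b∈K with ∈⇒chain n K Q b∈K
    ...   | k , V , k≤1+n , chain , Q⊆V = suc k , V , s≤s k≤1+n , I⟶K ∷ chain , Q⊆V

  -- A first arrow from `ζ X` leads to a point containing `X`, hence equal to `X` by maximality. It
  -- contributes no step, and this saves one in the length; an empty chain already ends at `ζ X`.
  chain-from-ζ : ∀ {X} → Maximal X → Chain k (ζ X) J → k ≤ suc n →
                 ∃ λ m → m ≤ n × ζ-Walk m X J
  chain-from-ζ X-max [] _ = zero , z≤n , inj₂ (stop-≋ (≋-sym ζζ≋))
  chain-from-ζ {X = X} X-max (_∷_ {J = Z} ζX⟶Z chain) (s≤s k≤n) with chain⇒walk chain
  ... | m , m≤k , w = m , ℕ-≤-trans m≤k k≤n ,
    ζ-Walk-resp (inj₁ (≋-sym (X-max Z (λ z → ζX⟶Z (⊆ζζ {X} z))))) (inj₁ ≋-refl) w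

-- The identity against a shortest walk.

theorem3p7 :
    (em : ∀ {a} → ExcludedMiddle a) →
    (zorn : ∀ {a ℓ₁ ℓ₂ r} → ZornsLemma a ℓ₁ ℓ₂ r) →
    ∀ {c ℓ} (L : PMAlgebra c ℓ) → Regular L →
    let open PMAlgebra L
        open Dual em L in
    ∀ (n : ℕ) → 1 ≤ n →
    ∃₂ (λ x y → ζ-dist x y ≡ [ n ]) →
    ¬ (∀ x → (x ∧ x ′ *) ⟨′*⟩^ (n ∸ 1) ≈ (x ∧ x ′ *) ⟨′*⟩^ n)
theorem3p7 em zorn {c} {ℓ} L regular (suc n) _ (x , y , dist≡) identity =
  [ no-walk (inj₁ ≋-refl) , no-walk ∼-ζ ]′ (proj₁ spec)
  where
  open PMAlgebra L
  open PMAlgebraProperties L using (≤-reflexive)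
  open DualProperties em L
  open Dual em L using (ζ)
  open PrimeIdeal using (set; down)

  spec = ζ-dist-spec dist≡

  -- The shortest walk ends at `y` or at `ζ y`; `z` covers both.
  no-walk : ∀ {z} → z ∼ y → ¬ Walk L (suc n) x z
  no-walk z∼y walk@(step {J = w} adj _)
    with X , X∼x , X-max ← maximal-rep regular {x} {w} adj
    with Q , Q∼z , Q-max , chain ← walk⇒chain regular X∼x X-max walk
    -- The arrow from `ζ X` to `X` is prefixed, giving `n + 2` arrows and so exponent `n + 1`. The
    -- identity lowers it to `n`, and at most `n + 1` arrows come back.
    with k , V , k≤1+n , chain′ , Q⊆V ← ∈⇒chain zorn n (ζ X) Q (λ {a} a∈Q →
           down (ζ X) (≤-reflexive (identity a)) (chain⇒∈ {I = ζ X} (ζζ⊆ {X} ∷ chain) a∈Q))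
    with m , m≤n , walk′ ← chain-from-ζ X-max chain′ k≤1+n
    -- Maximality of `Q` identifies `V` with `Q`, so `x` and `y` are joined, up to `ζ`, in at most
    -- `n` steps, below the minimum `suc n`.
    = <⇒≱ (s≤s m≤n) (proj₂ spec m
        (ζ-Walk-resp X∼x (∼-trans (inj₁ (≋-sym (Q-max V Q⊆V))) (∼-trans Q∼z z∼y)) walk′))
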